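{- There is an absolute constant $C>0$ such that for all integers $n\ge 2$ and $d\ge 1$ the following holds. Let $G=(V,E)$ be an $n$-vertex directed graph with two special vertices $s,t\in V$, whose edge weights are of the form $$\mathsf{wt}(e)=a_{e,1}\lambda_1+a_{e,2}\lambda_2+\cdots+a_{e,d}\lambda_d+a_{e,d+1},\qquad a_{e,i}\in\mathbb{R},$$ and let $S\subseteq\mathbb{R}^d$ be a feasible region for $G$, i.e. for every $\overline{x}\in S$ the graph $G$ has no negative-weight directed cycle at $\overline{\lambda}=\overline{x}$. Then $$|\mathrm{MSPC}_S(G)|\le n^{C d\log n},$$ that is, $|\mathrm{MSPC}_S(G)|\in n^{O(d\log n)}$.
   Context: Graphs are simple (no multi-edges or self-loops) and connected, and there is at least one path from $s$ to $t$. Logarithms are to base 2. The parameters $\overline{\lambda}=(\lambda_1,\dots,\lambda_d)\in\mathbb{R}^d$ are common to the entire graph, while the coefficients $a_{e,i}$ are fixed real constants for each edge. "At $\overline{\lambda}=\overline{x}$" refers to the fixed-edge-weight graph obtained by setting $\overline{\lambda}=\overline{x}$ in all edge weights. The weight of a path (or cycle) is the sum of the weights of its edges. Let $\mathcal{P}_{s,t}$ be the set of (simple) paths from $s$ to $t$ in $G$. For $S\subseteq\mathbb{R}^d$, $\mathrm{MSPC}_S(G)$ is a minimum-sized subset $\mathcal{S}\subseteq\mathcal{P}_{s,t}$ such that for every $\overline{x}\in S$ some path in $\mathcal{S}$ is a shortest path from $s$ to $t$ in $G$ at $\overline{\lambda}=\overline{x}$; $|\mathrm{MSPC}_S(G)|$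 denotes its size. When $S=\mathbb{R}^d$ one writes $\mathrm{MSPC}(G)$. -}

module Defs where

open import Algebra.Bundles using (CommutativeRing)
open import Data.Bool.Base using (Bool; T)
open import Data.Empty using (⊥)
open import Data.Fin.Base using (Fin)
open import Data.List.Base using (List; []; _∷_; length)
open import Data.List.Membership.Propositional using (_∈_)
open import Data.List.Relation.Unary.All using (All)
open import Data.List.Relation.Unary.Unique.Propositional using (Unique)
open import Data.Nat.Base as ℕ using (ℕ; suc; _^_)
open import Data.Product.Base using (∃; _×_)
open import Data.Vec.Functional using (Vector; init; last)
open import Level using (0ℓ) renaming (suc to lsuc)
open import Relation.Binary.Core using (Rel)
open import Relation.Binary.Construct.Closure.Equivalence using (EqClosure)
open import Relation.Binary.Construct.Closure.ReflexiveTransitive using (Star; ε; _◅_)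
open import Relation.Binary.Definitions using (Irreflexive)
open import Relation.Binary.PropositionalEquality.Core using (_≡_)
open import Relation.Binary.Structures using (IsTotalOrder)
open import Relation.Nullary.Negation.Core using (¬_)
open import Relation.Unary using (Pred)
import Algebra.Definitions.RawMonoid as RawMonoidDefinitions
import Relation.Binary.Construct.NonStrictToStrict as ToStrict

-- The axioms of a Dedekind-complete ordered field, which characterise ℝ up to
-- isomorphism in classical mathematics.  They are meant to be used together
-- with excluded middle: totality of the order is not a constructive property
-- of the real numbers.

record RealNumbers : Set (lsuc 0ℓ) where
  field
    commutativeRing : CommutativeRing 0ℓ 0ℓ

  open CommutativeRing commutativeRing public

  infix 4 _≤_

  field
    _≤_          : Rel Carrier 0ℓ
    isTotalOrder : IsTotalOrder _≈_ _≤_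
    1≉0          : ¬ (1# ≈ 0#)
    inverse      : ∀ x → ¬ (x ≈ 0#) → ∃ λ y → x * y ≈ 1#
    +-monoʳ-≤    : ∀ x {y z} → y ≤ z → x + y ≤ x + z
    *-nonneg     : ∀ {x y} → 0# ≤ x → 0# ≤ y → 0# ≤ x * y

  UpperBound : Pred Carrier 0ℓ → Pred Carrier 0ℓ
  UpperBound P b = ∀ x → P x → x ≤ b

  field
    supremum : ∀ (P : Pred Carrier 0ℓ) → ∃ P → ∃ (UpperBound P) →
               ∃ λ s → UpperBound P s × (∀ b → UpperBound P b → s ≤ b)

  open ToStrict _≈_ _≤_ public using (_<_)
  open RawMonoidDefinitions +-rawMonoid public using (sum)

-- Edges are given by a Bool-valued matrix, so that there is at most one edge
-- from u to v.

record Digraph (n : ℕ) : Set where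
  field
    adjacent : Fin n → Fin n → Bool

  Edge : Rel (Fin n) 0ℓ
  Edge u v = T (adjacent u v)

  field
    loopless : Irreflexive _≡_ Edge

  Connected : Set
  Connected = ∀ u v → EqClosure Edge u v

  Walk : Rel (Fin n) 0ℓ
  Walk = Star Edge

  vertices : ∀ {u v} → Walk u v → List (Fin n)
  vertices {u} ε       = u ∷ []
  vertices {u} (e ◅ w) = u ∷ vertices w

  IsPath : ∀ {u v} → Walk u v → Set
  IsPath w = Unique (vertices w)

  -- A cycle is an edge u → v followed by a simple path from v back to u.
  IsCycle : ∀ {u} → Walk u u → Set
  IsCycle ε       = ⊥
  IsCycle (e ◅ w) = IsPath w

-- Points of ℝ^d, that is, values of the parameters λ₁, …, λ_d.
Point : RealNumbers → ℕ → Set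
Point ℝ d = Vector (RealNumbers.Carrier ℝ) d

-- coeff e lists a_{e,1}, …, a_{e,d}, a_{e,d+1}; the last one is the constant
-- term.

record ParametricGraph (ℝ : RealNumbers) (n d : ℕ) : Set where
  open RealNumbers ℝ

  field
    digraph : Digraph n

  open Digraph digraph public

  field
    coeff : ∀ {u v} → Edge u v → Vector Carrier (suc d)

  wt : ∀ {u v} → Point ℝ d → Edge u v → Carrier
  wt x e = sum (λ i → init (coeff e) i * x i) + last (coeff e)

  weight : ∀ {u v} → Point ℝ d → Walk u v → Carrier
  weight x ε       = 0#
  weight x (e ◅ w) = wt x e + weight x w

module _ {ℝ : RealNumbers} {n d : ℕ} (G : ParametricGraph ℝ n d) where
  open RealNumbers ℝ
  open ParametricGraph G

  Feasible : Pred (Point ℝ d) 0ℓ → Set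
  Feasible S = ∀ x → S x → ∀ {u} (c : Walk u u) → IsCycle c → ¬ (weight x c < 0#)

  IsShortestPath : ∀ {s t} → Point ℝ d → Walk s t → Set
  IsShortestPath {s} {t} x p =
    IsPath p × (∀ (q : Walk s t) → IsPath q → weight x p ≤ weight x q)

  -- A duplicate-free list stands for a finite set of paths, and its length
  -- for the cardinality.
  IsCover : ∀ (S : Pred (Point ℝ d) 0ℓ) {s t} → List (Walk s t) → Set
  IsCover S ps = Unique ps × All IsPath ps ×
    (∀ x → S x → ∃ λ p → p ∈ ps × IsShortestPath x p)

  IsMSPC : ∀ (S : Pred (Point ℝ d) 0ℓ) {s t} → List (Walk s t) → Set
  IsMSPC S {s} {t} ps =
    IsCover S ps × (∀ (qs : List (Walk s t)) → IsCover S qs → length ps ℕ.≤ length qs)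

-- m ≼ b ^[ c ·log₂ n ] is the inequality m ≤ b ^ (c · log₂ n), with the
-- real-valued logarithm, for b ≥ 1 and n ≥ 1.  Indeed n ^ q ≤ 2 ^ p says that
-- log₂ n ≤ p / q, and m ^ q ≤ b ^ (c * p) says that m ≤ b ^ (c · p / q); since
-- the real power is monotone and continuous in its exponent, the inequality
-- holds at log₂ n iff it holds at all rationals p / q ≥ log₂ n.

infix 4 _≼_^[_·log₂_]

_≼_^[_·log₂_] : ℕ → ℕ → ℕ → ℕ → Set
m ≼ b ^[ c ·log₂ n ] = ∀ p q → 1 ℕ.≤ q → n ^ q ℕ.≤ 2 ^ p → m ^ q ℕ.≤ b ^ (c ℕ.* p)

{-# OPTIONS --safe #-}
-- Compute all-pairs shortest walks by repeated doubling: a lightest walk of at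
-- most 2 ^ (k + 1) edges from u to v joins, for some midpoint, two lightest walks
-- of at most 2 ^ k edges.  As long as the choices made at stage k are fixed, stage
-- k + 1 compares at most n candidates for each of the n² pairs, so its outcome
-- depends only on the signs of at most n⁴ linear forms in d + 1 homogeneous
-- coordinates.  Since m forms on ℝ^k have at most (m + 1) ^ k sign patterns, each
-- outcome of stage k branches into at most (n⁴ + 1) ^ (d + 1) outcomes of stage
-- k + 1, and ⌈log₂ n⌉ stages suffice for all simple paths.  The optimal walks are
-- made simple by erasing loops, which never adds weight at a feasible point.

module Submission where

open import Defs
open import Axiom.ExcludedMiddle using (ExcludedMiddle)
open import Data.Bool.Properties using (T?; T-irrelevant)
open import Data.Fin.Base using (Fin; zero; suc; inject₁; fromℕ)
open import Data.Fin.Properties as Fin using (_≟_)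
open import Data.List.Base using (List; []; _∷_; length; map; mapMaybe; _++_; concatMap; allFin; lookup; deduplicate)
open import Data.List.Properties using (length-map; length-mapMaybe; length-++; length-tabulate; length-deduplicate)
open import Data.List.Membership.Propositional using (_∈_; find; lose)
open import Data.List.Membership.Propositional.Properties using (∈-map⁺; ∈-concatMap⁺; ∈-allFin; ∈-deduplicate⁺; ∈-lookup)
import Data.List.Membership.DecPropositional as DecMembership
import Data.List.Extrema as Extrema
open import Data.List.Relation.Unary.All as All using (All; []; _∷_)
import Data.List.Relation.Unary.All.Properties as All
open import Data.List.Relation.Unary.AllPairs using ([]; _∷_)
open import Data.List.Relation.Unary.Any as Any using (Any; here; there)
import Data.List.Relation.Unary.Any.Properties as Any
open import Data.List.Relation.Unary.Unique.Propositional using (Unique)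
import Data.List.Relation.Unary.Unique.DecPropositional.Properties as Unique
open import Data.Maybe.Base using (Maybe; just; nothing; zipWith)
open import Data.Maybe.Relation.Unary.Any using (just; drop-just) renaming (Any to MAny)
open import Data.Nat.Base as ℕ using (ℕ; suc; zero; z≤n; s≤s)
open import Data.Nat.Induction using (<-wellFounded)
import Data.Nat.Properties as ℕ
open import Data.Nat.Tactic.RingSolver using (solve-∀)
open import Data.Product.Base using (∃; ∃₂; _×_; _,_; proj₁; proj₂)
open import Data.Sum.Base using (inj₁; inj₂)
open import Data.Vec.Functional using (Vector; removeAt; replicate; tail)
open import Function.Bundles using (_⇔_; mk⇔; Equivalence)
open import Function.Properties.Equivalence using (⇔-isEquivalence)
open import Induction.WellFounded using (Acc; acc)
open import Level using (0ℓ)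
open import Relation.Binary.Bundles using (TotalOrder)
open import Relation.Binary.Construct.Closure.ReflexiveTransitive using (ε; _◅_; _◅◅_)
open import Relation.Binary.Core using (Rel)
open import Relation.Binary.PropositionalEquality.Core as ≡ using (_≡_; refl)
open import Relation.Binary.Structures using (IsEquivalence)
open import Relation.Nullary using (¬_; Dec; yes; no; contradiction)
open import Relation.Unary using (Pred)
import Algebra.Properties.Ring as RingProperties
import Algebra.Properties.Semiring.Sum as SumProperties
import Relation.Binary.Reasoning.PartialOrder as PosetReasoning
import Relation.Binary.Reasoning.Setoid as SetoidReasoning

-- Representatives of the classes of a relation.

-- Index R N says that N elements meet every class of R.
Index : {A : Set} → Rel A 0ℓ → ℕ → Set
Index R N = ∃ λ xs → length xs ℕ.≤ N × ∀ x → Any (R x) xs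

index-mono : ∀ {A : Set} {R : Rel A 0ℓ} {M N} → M ℕ.≤ N → Index R M → Index R N
index-mono M≤N (xs , |xs|≤M , cover) = xs , ℕ.≤-trans |xs|≤M M≤N , cover

-- Each representative `y` is replaced by some `x` whose image is related to `y`, if there is one,
-- and dropped otherwise. Elements whose images share `y` have related images, so `reflects` applies
-- to them.
index-pullback : ExcludedMiddle 0ℓ → {A B : Set} (f : A → B) {R : Rel A 0ℓ} {R′ : Rel B 0ℓ} →
                 IsEquivalence R′ → (∀ x y → R′ (f x) (f y) → R x y) →
                 ∀ {N} → Index R′ N → Index R N
index-pullback em {A} f {R} {R′} eqv reflects (ys , |ys|≤N , covers) =
  mapMaybe g ys , ℕ.≤-trans (length-mapMaybe g ys) |ys|≤N ,
  λ x → Any.mapMaybe⁺ g ys (Any.map⁺ (Any.map (meets x) (covers (f x))))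
  where
  open IsEquivalence eqv

  g : _ → Maybe A
  g y with em {∃ λ x → R′ (f x) y}
  ... | yes (x , _) = just x
  ... | no  _       = nothing

  meets : ∀ x {y} → R′ (f x) y → MAny (R x) (g y)
  meets x {y} fx∼y with em {∃ λ x → R′ (f x) y}
  ... | yes (x′ , fx′∼y) = just (reflects x x′ (trans fx∼y (sym fx′∼y)))
  ... | no  ∄x           = contradiction (x , fx∼y) ∄x

-- The inductive step of the bound `(m + 1) ^ k` on sign patterns: a further form costs at most the
-- number of patterns of the other forms on a space of one dimension less.
^-suc-sum-≤ : ∀ m k → suc m ℕ.^ suc k ℕ.+ suc m ℕ.^ k ℕ.≤ suc (suc m) ℕ.^ suc k
^-suc-sum-≤ m k = begin
  suc m ℕ.* suc m ℕ.^ k ℕ.+ suc m ℕ.^ k  ≡⟨ ℕ.+-comm (suc m ℕ.* suc m ℕ.^ k) _ ⟩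
  suc (suc m) ℕ.* suc m ℕ.^ k            ≤⟨ ℕ.*-monoʳ-≤ (suc (suc m)) (ℕ.^-monoˡ-≤ k (ℕ.n≤1+n (suc m))) ⟩
  suc (suc m) ℕ.* suc (suc m) ℕ.^ k      ∎
  where open ℕ.≤-Reasoning

-- Ordered-field arithmetic and linear forms.

module LinearForms (ℝ : RealNumbers) where
  open RealNumbers ℝ hiding (zero) renaming (refl to ≈-refl)
  open RingProperties ring
  open SumProperties semiring using (sum-remove; ∑-distrib-+; *-distribˡ-sum; sum-cong-≋; sum-replicate-zero)

  totalOrder : TotalOrder 0ℓ 0ℓ 0ℓ
  totalOrder = record { isTotalOrder = isTotalOrder }

  open TotalOrder totalOrder public using (poset; total)
    renaming (refl to ≤-refl; reflexive to ≤-reflexive; trans to ≤-trans; antisym to ≤-antisym)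

  private
    module ≤-Reasoning = PosetReasoning poset
    module ≈-Reasoning = SetoidReasoning setoid

  -‿nonneg : ∀ {x} → x ≤ 0# → 0# ≤ - x
  -‿nonneg {x} x≤0 = begin
    0#        ≈⟨ -‿inverseˡ x ⟨
    - x + x   ≤⟨ +-monoʳ-≤ (- x) x≤0 ⟩
    - x + 0#  ≈⟨ +-identityʳ (- x) ⟩
    - x       ∎
    where open ≤-Reasoning

  ≤⇒0≤- : ∀ {x y} → x ≤ y → 0# ≤ y - x
  ≤⇒0≤- {x} {y} x≤y = begin
    0#       ≈⟨ -‿inverseˡ x ⟨
    - x + x  ≤⟨ +-monoʳ-≤ (- x) x≤y ⟩
    - x + y  ≈⟨ +-comm (- x) y ⟩
    y - x    ∎
    where open ≤-Reasoning

  0≤-⇒≤ : ∀ {x y} → 0# ≤ y - x → x ≤ y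
  0≤-⇒≤ {x} {y} 0≤y-x = begin
    x            ≈⟨ +-identityʳ x ⟨
    x + 0#       ≤⟨ +-monoʳ-≤ x 0≤y-x ⟩
    x + (y - x)  ≈⟨ +-assoc x y (- x) ⟨
    x + y - x    ≈⟨ xyx⁻¹≈y x y ⟩
    y            ∎
    where open ≤-Reasoning

  +-mono-≤ : ∀ {x y u v} → x ≤ y → u ≤ v → x + u ≤ y + v
  +-mono-≤ {x} {y} {u} {v} x≤y u≤v = begin
    x + u  ≤⟨ +-monoʳ-≤ x u≤v ⟩
    x + v  ≈⟨ +-comm x v ⟩
    v + x  ≤⟨ +-monoʳ-≤ v x≤y ⟩
    v + y  ≈⟨ +-comm v y ⟩
    y + v  ∎
    where open ≤-Reasoning

  ≰⇒0≤- : ∀ {x} → ¬ (0# ≤ x) → 0# ≤ - x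
  ≰⇒0≤- {x} 0≰x with total 0# x
  ... | inj₁ 0≤x = contradiction 0≤x 0≰x
  ... | inj₂ x≤0 = -‿nonneg x≤0

  +-nonneg : ∀ {x y} → 0# ≤ x → 0# ≤ y → 0# ≤ x + y
  +-nonneg 0≤x 0≤y = ≤-trans (≤-reflexive (sym (+-identityʳ 0#))) (+-mono-≤ 0≤x 0≤y)

  -- If `y ≤ 0#`, then `x * y` is both nonnegative and nonpositive, hence zero, and the inverse of
  -- `x` shows that `y` is zero.
  *-cancelˡ-nonneg : ∀ {x y} → 0# ≤ x → ¬ (x ≈ 0#) → 0# ≤ x * y → 0# ≤ y
  *-cancelˡ-nonneg {x} {y} 0≤x x≉0 0≤xy with total 0# y
  ... | inj₁ 0≤y = 0≤y
  ... | inj₂ y≤0 = ≤-reflexive (begin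
    0#             ≈⟨ zeroʳ x⁻¹ ⟨
    x⁻¹ * 0#       ≈⟨ *-congˡ (≤-antisym 0≤xy xy≤0) ⟩
    x⁻¹ * (x * y)  ≈⟨ *-assoc x⁻¹ x y ⟨
    x⁻¹ * x * y    ≈⟨ *-congʳ (trans (*-comm x⁻¹ x) (proj₂ (inverse x x≉0))) ⟩
    1# * y         ≈⟨ *-identityˡ y ⟩
    y              ∎)
    where
    open ≈-Reasoning
    x⁻¹ = proj₁ (inverse x x≉0)
    xy≤0 : x * y ≤ 0#
    xy≤0 = 0≤-⇒≤ (≤-trans (*-nonneg 0≤x (-‿nonneg y≤0))
             (≤-reflexive (trans (sym (-‿distribʳ-* x y)) (sym (+-identityˡ _)))))

  dot : ∀ {k} → Vector Carrier k → Vector Carrier k → Carrier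
  dot g x = sum (λ i → g i * x i)

  dot-linearˡ : ∀ {k} a (g : Vector Carrier k) b h x →
                dot (λ i → a * g i + b * h i) x ≈ a * dot g x + b * dot h x
  dot-linearˡ a g b h x = begin
    sum (λ i → (a * g i + b * h i) * x i)
      ≈⟨ sum-cong-≋ (λ i → trans (distribʳ (x i) _ _) (+-cong (*-assoc a (g i) (x i)) (*-assoc b (h i) (x i)))) ⟩
    sum (λ i → a * (g i * x i) + b * (h i * x i))
      ≈⟨ ∑-distrib-+ (λ i → a * (g i * x i)) (λ i → b * (h i * x i)) ⟩
    sum (λ i → a * (g i * x i)) + sum (λ i → b * (h i * x i))
      ≈⟨ +-cong (*-distribˡ-sum a (λ i → g i * x i)) (*-distribˡ-sum b (λ i → h i * x i)) ⟨
    a * dot g x + b * dot h x ∎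
    where open ≈-Reasoning

  dot-comm : ∀ {k} (g x : Vector Carrier k) → dot g x ≈ dot x g
  dot-comm g x = sum-cong-≋ (λ i → *-comm (g i) (x i))

  dot-linearʳ : ∀ {k} (g : Vector Carrier k) a x b y →
                dot g (λ i → a * x i + b * y i) ≈ a * dot g x + b * dot g y
  dot-linearʳ g a x b y = begin
    dot g (λ i → a * x i + b * y i)  ≈⟨ dot-comm g _ ⟩
    dot (λ i → a * x i + b * y i) g  ≈⟨ dot-linearˡ a x b y g ⟩
    a * dot x g + b * dot y g        ≈⟨ +-cong (*-congˡ (dot-comm x g)) (*-congˡ (dot-comm y g)) ⟩
    a * dot g x + b * dot g y        ∎
    where open ≈-Reasoning

  dot-+ˡ : ∀ {k} (g h x : Vector Carrier k) → dot (λ i → g i + h i) x ≈ dot g x + dot h x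
  dot-+ˡ g h x = trans (sum-cong-≋ (λ i → distribʳ (x i) (g i) (h i)))
                       (∑-distrib-+ (λ i → g i * x i) (λ i → h i * x i))

  dot-‿-ˡ : ∀ {k} (g h x : Vector Carrier k) → dot (λ i → g i - h i) x ≈ dot g x - dot h x
  dot-‿-ˡ g h x = begin
    dot (λ i → g i - h i) x
      ≈⟨ sum-cong-≋ (λ i → *-congʳ (+-cong (*-identityˡ (g i)) (-1*x≈-x (h i)))) ⟨
    dot (λ i → 1# * g i + - 1# * h i) x  ≈⟨ dot-linearˡ 1# g (- 1#) h x ⟩
    1# * dot g x + - 1# * dot h x        ≈⟨ +-cong (*-identityˡ _) (-1*x≈-x _) ⟩
    dot g x - dot h x                    ∎
    where open ≈-Reasoning

  dot-zeroˡ : ∀ {k} {g : Vector Carrier k} x → (∀ i → g i ≈ 0#) → dot g x ≈ 0#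
  dot-zeroˡ {k} x g≈0 = trans (sum-cong-≋ (λ i → trans (*-congʳ (g≈0 i)) (zeroˡ (x i)))) (sum-replicate-zero k)

  -- Sign patterns of finitely many linear forms.

  -- Signs are two-valued, with zero counted as positive: comparing two weights by `≤` only asks
  -- whether their difference is nonnegative.
  NonNeg : ∀ {k} → Vector Carrier k → Vector Carrier k → Set
  NonNeg g x = 0# ≤ dot g x

  SameSigns : ∀ {k} → List (Vector Carrier k) → Rel (Vector Carrier k) 0ℓ
  SameSigns gs x y = All (λ g → NonNeg g x ⇔ NonNeg g y) gs

  -- The points carry proofs that `f` vanishes there, so the representatives in an `Index` lie on
  -- the hyperplane themselves and their sign under `f` is known.
  SameSignsOn : ∀ {k} (f : Vector Carrier k) → List (Vector Carrier k) → Rel (∃ λ x → dot f x ≈ 0#) 0ℓ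
  SameSignsOn f gs (x , _) (y , _) = SameSigns gs x y

  sameSigns-isEquivalence : ∀ {k} (gs : List (Vector Carrier k)) → IsEquivalence (SameSigns gs)
  sameSigns-isEquivalence gs = record
    { refl  = All.universal (λ _ → ⇔.refl) gs
    ; sym   = All.map ⇔.sym
    ; trans = λ xy yz → All.zipWith (λ (p , q) → ⇔.trans p q) (xy , yz)
    }
    where module ⇔ = IsEquivalence (⇔-isEquivalence {ℓ = 0ℓ})

  -- The segment between two points on different sides of the hyperplane f = 0
  -- meets it, and every g that has the same sign at both ends keeps that sign.
  crossing : ∀ {k} (f : Vector Carrier k) gs {x z} → NonNeg f x → ¬ NonNeg f z → SameSigns gs x z →
             ∃ λ y → dot f y ≈ 0# × SameSigns gs x y
  crossing f gs {x} {z} 0≤fx 0≰fz x∼z = y , fy≈0 , All.map keep x∼z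
    where
    -- The weights are not normalised: `y` is a positive multiple of the point where the segment
    -- meets the hyperplane, which leaves all signs unchanged.
    a = - dot f z
    b = dot f x

    y = λ i → a * x i + b * z i

    0≤a : 0# ≤ a
    0≤a = ≰⇒0≤- 0≰fz

    a≉0 : ¬ (a ≈ 0#)
    a≉0 a≈0 = 0≰fz (≤-reflexive (begin
      0#      ≈⟨ -0#≈0# ⟨
      - 0#    ≈⟨ -‿cong a≈0 ⟨
      - a     ≈⟨ -‿involutive _ ⟩
      dot f z ∎))
      where open ≈-Reasoning

    fy≈0 : dot f y ≈ 0#
    fy≈0 = begin
      dot f y                                    ≈⟨ dot-linearʳ f a x b z ⟩
      - dot f z * dot f x + dot f x * dot f z    ≈⟨ +-congʳ (-‿distribˡ-* _ _) ⟨
      - (dot f z * dot f x) + dot f x * dot f z  ≈⟨ +-congˡ (*-comm _ _) ⟩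
      - (dot f z * dot f x) + dot f z * dot f x  ≈⟨ -‿inverseˡ _ ⟩
      0#                                         ∎
      where open ≈-Reasoning

    keep : ∀ {g} → NonNeg g x ⇔ NonNeg g z → NonNeg g x ⇔ NonNeg g y
    keep {g} gx⇔gz = mk⇔ to from
      where
      gy≈ = dot-linearʳ g a x b z

      to : NonNeg g x → NonNeg g y
      to 0≤gx = ≤-trans (+-nonneg (*-nonneg 0≤a 0≤gx) (*-nonneg 0≤fx (Equivalence.to gx⇔gz 0≤gx)))
                        (≤-reflexive (sym gy≈))

      from : NonNeg g y → NonNeg g x
      from 0≤gy with total 0# (dot g z)
      ... | inj₁ 0≤gz = Equivalence.from gx⇔gz 0≤gz
      -- Here `a * dot g x` is `dot g y` plus a nonnegative term, and `a` can be cancelled because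
      -- `z` lies strictly on the negative side of `f`.
      ... | inj₂ gz≤0 = *-cancelˡ-nonneg 0≤a a≉0 (begin
        0#                                         ≤⟨ +-nonneg 0≤gy (*-nonneg 0≤fx (-‿nonneg gz≤0)) ⟩
        dot g y + b * - dot g z                    ≈⟨ +-cong gy≈ (sym (-‿distribʳ-* b _)) ⟩
        a * dot g x + b * dot g z - b * dot g z    ≈⟨ +-assoc _ _ _ ⟩
        a * dot g x + (b * dot g z - b * dot g z)  ≈⟨ +-congˡ (-‿inverseʳ _) ⟩
        a * dot g x + 0#                           ≈⟨ +-identityʳ _ ⟩
        a * dot g x                                ∎)
        where open ≤-Reasoning

  -- Solving f = 0 for its j-th coordinate turns g into a form in the others; r
  -- stands for the inverse of f j.
  eliminate : ∀ {k} → Vector Carrier (suc k) → Fin (suc k) → Carrier → Vector Carrier (suc k) → Vector Carrier k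
  eliminate f j r g = removeAt (λ i → 1# * g i + - (g j * r) * f i) j

  -- Adding a multiple of `f` to `g` changes nothing where `f` vanishes, and this multiple cancels
  -- the `j`-th coefficient.
  dot-eliminate : ∀ {k} (f : Vector Carrier (suc k)) j {r} → f j * r ≈ 1# → ∀ g {x} → dot f x ≈ 0# →
                  dot g x ≈ dot (eliminate f j r g) (removeAt x j)
  dot-eliminate f j {r} fr≈1 g {x} fx≈0 = begin
    dot g x                             ≈⟨ +-identityʳ _ ⟨
    dot g x + 0#                        ≈⟨ +-cong (*-identityˡ _) (trans (*-congˡ fx≈0) (zeroʳ c)) ⟨
    1# * dot g x + c * dot f x          ≈⟨ dot-linearˡ 1# g c f x ⟨
    dot h x                             ≈⟨ sum-remove {i = j} (λ i → h i * x i) ⟩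
    h j * x j + dot (removeAt h j) _    ≈⟨ +-congʳ (trans (*-congʳ hj≈0) (zeroˡ (x j))) ⟩
    0# + dot (removeAt h j) _           ≈⟨ +-identityˡ _ ⟩
    dot (removeAt h j) (removeAt x j)   ∎
    where
    open ≈-Reasoning
    c = - (g j * r)
    h = λ i → 1# * g i + c * f i
    hj≈0 : h j ≈ 0#
    hj≈0 = begin
      1# * g j + - (g j * r) * f j  ≈⟨ +-cong (*-identityˡ _) (sym (-‿distribˡ-* _ _)) ⟩
      g j - g j * r * f j           ≈⟨ +-congˡ (-‿cong (*-assoc _ _ _)) ⟩
      g j - g j * (r * f j)         ≈⟨ +-congˡ (-‿cong (*-congˡ (trans (*-comm r (f j)) fr≈1))) ⟩
      g j - g j * 1#                ≈⟨ +-congˡ (-‿cong (*-identityʳ _)) ⟩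
      g j - g j                     ≈⟨ -‿inverseʳ _ ⟩
      0#                            ∎

  module _ (em : ExcludedMiddle 0ℓ) where

    -- Dropping the `j`-th coordinate maps the hyperplane into a space of one dimension less and
    -- turns each `g` into its eliminated form with the same values. The last argument is the
    -- induction hypothesis in that dimension.
    index-hyperplane : ∀ {k} (f : Vector Carrier (suc k)) {j} → ¬ (f j ≈ 0#) → ∀ gs →
                       (∀ gs′ → Index (SameSigns {k} gs′) (suc (length gs′) ℕ.^ k)) →
                       Index (SameSignsOn f gs) (suc (length gs) ℕ.^ k)
    index-hyperplane {k} f {j} fj≉0 gs index =
      index-pullback em (λ x → removeAt (proj₁ x) j) (sameSigns-isEquivalence (map e gs)) reflects
        (≡.subst (λ m → Index (SameSigns (map e gs)) (suc m ℕ.^ k)) (length-map e gs) (index (map e gs)))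
      where
      e = eliminate f j (proj₁ (inverse (f j) fj≉0))

      dot≈ : ∀ g {x} → dot f x ≈ 0# → dot g x ≈ dot (e g) (removeAt x j)
      dot≈ g {x} = dot-eliminate f j (proj₂ (inverse (f j) fj≉0)) g {x}

      reflects : ∀ x y → SameSigns (map e gs) (removeAt (proj₁ x) j) (removeAt (proj₁ y) j) → SameSignsOn f gs x y
      reflects (x , fx≈0) (y , fy≈0) same = All.map (λ {g} g⇔ → mk⇔
        (λ 0≤gx → ≤-trans (Equivalence.to g⇔ (≤-trans 0≤gx (≤-reflexive (dot≈ g {x} fx≈0))))
                          (≤-reflexive (sym (dot≈ g {y} fy≈0))))
        (λ 0≤gy → ≤-trans (Equivalence.from g⇔ (≤-trans 0≤gy (≤-reflexive (dot≈ g {y} fy≈0))))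
                          (≤-reflexive (sym (dot≈ g {x} fx≈0)))))
        (All.map⁻ same)

    -- A class of SameSigns gs that f splits is met by the hyperplane f = 0.
    -- Representatives are moved to the side ¬ 0 ≤ f whenever possible, so that
    -- the missing half is represented by a point of that hyperplane.
    index-cons : ∀ {k} (f : Vector Carrier k) gs {M N} → Index (SameSigns gs) M →
                 Index (SameSignsOn f gs) N →
                 Index (SameSigns (f ∷ gs)) (M ℕ.+ N)
    index-cons {k} f gs {M} {N} (xs , |xs|≤M , xs-cover) (ys , |ys|≤N , ys-cover) =
      map lower xs ++ map proj₁ ys , bound , cover
      where
      open IsEquivalence (sameSigns-isEquivalence gs) using () renaming (sym to ∼-sym; trans to ∼-trans)

      Low : Vector Carrier k → Set
      Low x = ∃ λ z → SameSigns gs x z × ¬ NonNeg f z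

      lower : Vector Carrier k → Vector Carrier k
      lower x with em {Low x}
      ... | yes (z , _) = z
      ... | no  _       = x

      bound : length (map lower xs ++ map proj₁ ys) ℕ.≤ M ℕ.+ N
      bound = begin
        length (map lower xs ++ map proj₁ ys)          ≡⟨ length-++ (map lower xs) ⟩
        length (map lower xs) ℕ.+ length (map proj₁ ys) ≡⟨ ≡.cong₂ ℕ._+_ (length-map lower xs) (length-map proj₁ ys) ⟩
        length xs ℕ.+ length ys                        ≤⟨ ℕ.+-mono-≤ |xs|≤M |ys|≤N ⟩
        M ℕ.+ N                                        ∎
        where open ℕ.≤-Reasoning

      lower-same : ∀ {x p} → SameSigns gs x p → ¬ NonNeg f x → SameSigns (f ∷ gs) x (lower p)
      lower-same {x} {p} x∼p 0≰fx with em {Low p}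
      ... | yes (z , p∼z , 0≰fz) =
        mk⇔ (λ 0≤fx → contradiction 0≤fx 0≰fx) (λ 0≤fz → contradiction 0≤fz 0≰fz) ∷ ∼-trans x∼p p∼z
      ... | no  none             = contradiction (x , ∼-sym x∼p , 0≰fx) none

      unsplit-same : ∀ {x p} → SameSigns gs x p → NonNeg f x → ¬ Low x → SameSigns (f ∷ gs) x (lower p)
      unsplit-same {x} {p} x∼p 0≤fx ¬low with em {Low p} | em {NonNeg f p}
      ... | yes (z , p∼z , 0≰fz) | _        = contradiction (z , ∼-trans x∼p p∼z , 0≰fz) ¬low
      ... | no  none             | yes 0≤fp = mk⇔ (λ _ → 0≤fp) (λ _ → 0≤fx) ∷ x∼p
      ... | no  none             | no 0≰fp  = contradiction (p , x∼p , 0≰fp) ¬low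

      cover : ∀ x → Any (SameSigns (f ∷ gs) x) (map lower xs ++ map proj₁ ys)
      cover x with em {NonNeg f x} | em {Low x}
      ... | no 0≰fx  | _ = Any.++⁺ˡ (Any.map⁺ (Any.map (λ x∼p → lower-same x∼p 0≰fx) (xs-cover x)))
      ... | yes 0≤fx | no ¬low =
        Any.++⁺ˡ (Any.map⁺ (Any.map (λ x∼p → unsplit-same x∼p 0≤fx ¬low) (xs-cover x)))
      ... | yes 0≤fx | yes (z , x∼z , 0≰fz) with crossing f gs 0≤fx 0≰fz x∼z
      ... | y , fy≈0 , x∼y = Any.++⁺ʳ (map lower xs) (Any.map⁺ (Any.map
              (λ {(q , fq≈0)} y∼q → mk⇔ (λ _ → ≤-reflexive (sym fq≈0)) (λ _ → 0≤fx) ∷ ∼-trans x∼y y∼q)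
              (ys-cover (y , fy≈0))))

    index-trivial : ∀ {k} {f : Vector Carrier k} gs {N} → (∀ x → dot f x ≈ 0#) →
                    Index (SameSigns gs) N → Index (SameSigns (f ∷ gs)) N
    index-trivial gs f≈0 (xs , |xs|≤N , cover) = xs , |xs|≤N , λ x →
      Any.map (λ {p} x∼p → mk⇔ (λ _ → ≤-reflexive (sym (f≈0 p))) (λ _ → ≤-reflexive (sym (f≈0 x))) ∷ x∼p) (cover x)

    -- The recursion that counts cells of a hyperplane arrangement: a nonzero form adds at most as
    -- many patterns as the other forms have on its hyperplane, and a zero form adds none.
    sign-patterns : ∀ k (gs : List (Vector Carrier k)) → Index (SameSigns gs) (suc (length gs) ℕ.^ k)
    sign-patterns k []       = replicate k 0# ∷ [] , ℕ.≤-reflexive (≡.sym (ℕ.^-zeroˡ k)) , λ _ → here []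
    sign-patterns k (f ∷ gs) with em {∃ λ j → ¬ (f j ≈ 0#)}
    sign-patterns k (f ∷ gs) | no  f≡0 =
      index-mono (ℕ.^-monoˡ-≤ k (ℕ.n≤1+n _)) (index-trivial gs (λ x → dot-zeroˡ x zero-at) (sign-patterns k gs))
      where
      zero-at : ∀ i → f i ≈ 0#
      zero-at i with em {f i ≈ 0#}
      ... | yes fi≈0 = fi≈0
      ... | no  fi≉0 = contradiction (i , fi≉0) f≡0
    -- A nonzero coefficient has an index in `Fin k`, so dimension zero cannot occur here.
    sign-patterns (suc k) (f ∷ gs) | yes (_ , fj≉0) =
      index-mono (^-suc-sum-≤ (length gs) k)
        (index-cons f gs (sign-patterns (suc k) gs) (index-hyperplane f fj≉0 gs (sign-patterns k)))

-- Finite lists.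

length-concatMap-≤ : ∀ {A B : Set} (f : A → List B) {m} → (∀ x → length (f x) ℕ.≤ m) →
                     ∀ xs → length (concatMap f xs) ℕ.≤ length xs ℕ.* m
length-concatMap-≤ f f≤m []       = z≤n
length-concatMap-≤ f {m} f≤m (x ∷ xs) = begin
  length (f x ++ concatMap f xs)            ≡⟨ length-++ (f x) ⟩
  length (f x) ℕ.+ length (concatMap f xs)  ≤⟨ ℕ.+-mono-≤ (f≤m x) (length-concatMap-≤ f f≤m xs) ⟩
  m ℕ.+ length xs ℕ.* m                     ∎
  where open ℕ.≤-Reasoning

unique-lookup-injective : ∀ {A : Set} {xs : List A} → Unique xs → ∀ {i j} → lookup xs i ≡ lookup xs j → i ≡ j
unique-lookup-injective (_ ∷ _)     {zero}  {zero}  _  = refl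
unique-lookup-injective (x∉xs ∷ _)  {zero}  {suc j} eq = contradiction eq (All.lookup x∉xs (∈-lookup j))
unique-lookup-injective (x∉xs ∷ _)  {suc i} {zero}  eq = contradiction (≡.sym eq) (All.lookup x∉xs (∈-lookup i))
unique-lookup-injective (_ ∷ xs!)   {suc i} {suc j} eq = ≡.cong suc (unique-lookup-injective xs! eq)

-- Descent on the length, where excluded middle decides whether a shorter list exists. It extracts a
-- minimum cover from any cover.
shortest-list : ExcludedMiddle 0ℓ → {A : Set} (P : Pred (List A) 0ℓ) → ∀ {xs} → P xs →
                ∃ λ ys → P ys × (∀ zs → P zs → length ys ℕ.≤ length zs)
shortest-list em {A} P pxs = go pxs (<-wellFounded _)
  where
  go : ∀ {xs} → P xs → Acc ℕ._<_ (length xs) → ∃ λ ys → P ys × (∀ zs → P zs → length ys ℕ.≤ length zs)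
  go {xs} pxs (acc rs) with em {∃ λ zs → P zs × length zs ℕ.< length xs}
  ... | yes (zs , pzs , shorter) = go pzs (rs shorter)
  ... | no  none                 = xs , pxs , λ zs pzs → ℕ.≮⇒≥ (λ shorter → none (zs , pzs , shorter))

-- Splitting walks and simple paths.

module Walks {n} (D : Digraph n) where
  open Digraph D

  steps : ∀ {u v} → Walk u v → ℕ
  steps ε       = 0
  steps (e ◅ w) = suc (steps w)

  split : ∀ k {l u v} (w : Walk u v) → steps w ℕ.≤ k ℕ.+ l →
          ∃ λ m → ∃₂ λ (a : Walk u m) (b : Walk m v) → a ◅◅ b ≡ w × steps a ℕ.≤ k × steps b ℕ.≤ l
  split zero    w       |w|≤       = _ , ε , w , refl , z≤n , |w|≤
  -- A walk of fewer than `k` edges is followed by the empty walk, with its own end as the midpoint.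
  split (suc k) ε       _          = _ , ε , ε , refl , z≤n , z≤n
  split (suc k) (e ◅ w) (s≤s |w|≤) with split k w |w|≤
  ... | m , a , b , refl , |a|≤k , |b|≤l = m , e ◅ a , b , refl , s≤s |a|≤k , |b|≤l

  length-vertices : ∀ {u v} (w : Walk u v) → length (vertices w) ≡ suc (steps w)
  length-vertices ε       = refl
  length-vertices (e ◅ w) = ≡.cong suc (length-vertices w)

  -- Pigeonhole: the distinct vertices inject into `Fin n`. This would give `n - 1` edges; the
  -- weaker bound `n` is the one compared with `2 ^ k`.
  path-steps≤n : ∀ {u v} (w : Walk u v) → IsPath w → steps w ℕ.≤ n
  path-steps≤n w path = begin
    steps w              ≤⟨ ℕ.n≤1+n _ ⟩
    suc (steps w)        ≡⟨ length-vertices w ⟨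
    length (vertices w)  ≤⟨ Fin.injective⇒≤ (unique-lookup-injective path) ⟩
    n                    ∎
    where open ℕ.≤-Reasoning

  All-vertices-◅◅⁻ : ∀ {P : Pred (Fin n) 0ℓ} {u m v} (a : Walk u m) {b : Walk m v} →
                     All P (vertices (a ◅◅ b)) → All P (vertices a)
  All-vertices-◅◅⁻ ε {ε}     (pu ∷ _)  = pu ∷ []
  All-vertices-◅◅⁻ ε {_ ◅ _} (pu ∷ _)  = pu ∷ []
  All-vertices-◅◅⁻ (e ◅ a)   (pu ∷ ps) = pu ∷ All-vertices-◅◅⁻ a ps

  -- Serves loop erasure: an edge into the first part closes it to a cycle, and the second part is
  -- kept.
  cut : ∀ {u v m} (w : Walk u v) → IsPath w → m ∈ vertices w →
        ∃₂ λ (a : Walk u m) (b : Walk m v) → a ◅◅ b ≡ w × IsPath a × IsPath b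
  cut ε       path (here refl) = ε , ε , refl , path , path
  cut (e ◅ w) path (here refl) = ε , e ◅ w , refl , [] ∷ [] , path
  cut (e ◅ w) (u∉w ∷ path) (there m∈w) with cut w path m∈w
  ... | a , b , refl , a-path , b-path = e ◅ a , b , refl , All-vertices-◅◅⁻ a u∉w ∷ a-path , b-path

-- Weights as linear forms, and tables of lightest walks.

module Tables {ℝ : RealNumbers} {n d : ℕ} (G : ParametricGraph ℝ n d) where
  open RealNumbers ℝ hiding (zero) renaming (refl to ≈-refl)
  open LinearForms ℝ
  open ParametricGraph G
  open Walks digraph
  open SumProperties semiring using (sum-init-last; sum-cong-≋)
  open Extrema totalOrder using (argmin; argmin-all; f[argmin]≤f[⊤]; f[argmin]≤f[xs])

  private
    module ≤-Reasoning = PosetReasoning poset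
    module ≈-Reasoning = SetoidReasoning setoid

  -- A point (x₁, …, x_d) becomes (x₁, …, x_d, 1), so that weights are linear forms.
  homogenise : ∀ {k} → Vector Carrier k → Vector Carrier (suc k)
  homogenise {zero}  x _       = 1#
  homogenise {suc k} x zero    = x zero
  homogenise {suc k} x (suc i) = homogenise (tail x) i

  homogenise-inject₁ : ∀ {k} (x : Vector Carrier k) i → homogenise x (inject₁ i) ≡ x i
  homogenise-inject₁ x zero    = refl
  homogenise-inject₁ x (suc i) = homogenise-inject₁ (tail x) i

  homogenise-fromℕ : ∀ {k} (x : Vector Carrier k) → homogenise x (fromℕ k) ≡ 1#
  homogenise-fromℕ {zero}  x = refl
  homogenise-fromℕ {suc k} x = homogenise-fromℕ (tail x)

  dot-coeff : ∀ x {u v} (e : Edge u v) → dot (coeff e) (homogenise x) ≈ wt x e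
  dot-coeff x e = trans (sum-init-last (λ i → coeff e i * homogenise x i)) (+-cong
    (sum-cong-≋ (λ i → *-congˡ (reflexive (homogenise-inject₁ x i))))
    (trans (*-congˡ (reflexive (homogenise-fromℕ x))) (*-identityʳ _)))

  form : ∀ {u v} → Walk u v → Vector Carrier (suc d)
  form ε       i = 0#
  form (e ◅ w) i = coeff e i + form w i

  dot-form : ∀ x {u v} (w : Walk u v) → dot (form w) (homogenise x) ≈ weight x w
  dot-form x ε       = dot-zeroˡ (homogenise x) (λ _ → ≈-refl)
  dot-form x (e ◅ w) = trans (dot-+ˡ (coeff e) (form w) (homogenise x)) (+-cong (dot-coeff x e) (dot-form x w))

  weight-◅◅ : ∀ x {u m v} (a : Walk u m) (b : Walk m v) → weight x (a ◅◅ b) ≈ weight x a + weight x b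
  weight-◅◅ x ε       b = sym (+-identityˡ _)
  weight-◅◅ x (e ◅ a) b = trans (+-congˡ (weight-◅◅ x a b)) (sym (+-assoc _ _ _))

  -- The entry at (u, v) is nothing when no walk from u to v has been found.
  Table : Set
  Table = ∀ u v → Maybe (Walk u v)

  -- Only the competitors are limited to `k` edges, not the entry itself. `MAny` also forces an
  -- entry wherever a competitor exists.
  Optimal : ℕ → Point ℝ d → Table → Set
  Optimal k x T = ∀ u v (q : Walk u v) → steps q ℕ.≤ k → MAny (λ p → weight x p ≤ weight x q) (T u v)

  edges : Table
  edges u v with u ≟ v | T? (adjacent u v)
  -- Without loops, the empty walk is the only walk of at most one edge from a vertex to itself.
  ... | yes refl | _     = just ε
  ... | no _     | yes e = just (e ◅ ε)
  ... | no _     | no _  = nothing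

  edges-optimal : ∀ x → Optimal 1 x edges
  edges-optimal x u _ ε _ with u ≟ u | T? (adjacent u u)
  ... | yes refl | _ = just ≤-refl
  ... | no u≢u   | _ = contradiction refl u≢u
  edges-optimal x u v (e ◅ ε) _ with u ≟ v | T? (adjacent u v)
  ... | yes refl | _      = contradiction e (loopless refl)
  ... | no _     | yes e′ = just (≤-reflexive (reflexive (≡.cong (λ e → weight x (e ◅ ε)) (T-irrelevant e′ e))))
  ... | no _     | no ¬e  = contradiction e ¬e
  edges-optimal x _ _ (_ ◅ _ ◅ _) (s≤s ())

  join : Table → ∀ u v → Fin n → Maybe (Walk u v)
  join T u v m = zipWith _◅◅_ (T u m) (T m v)

  candidates : Table → ∀ u v → List (Walk u v)
  candidates T u v = mapMaybe (join T u v) (allFin n)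

  length-allFin : length (allFin n) ≡ n
  length-allFin = length-tabulate {n = n} (λ i → i)

  length-candidates : ∀ T u v → length (candidates T u v) ℕ.≤ n
  length-candidates T u v = ℕ.≤-trans (length-mapMaybe (join T u v) (allFin n)) (ℕ.≤-reflexive length-allFin)

  -- Each half of `q` is replaced by the table entry with the same ends, and the results are joined
  -- at the midpoint.
  candidates-optimal : ∀ {k x T} → Optimal k x T → ∀ u v (q : Walk u v) → steps q ℕ.≤ k ℕ.+ k →
                       Any (λ p → weight x p ≤ weight x q) (candidates T u v)
  candidates-optimal {k} {x} {T} opt u v q |q|≤ with split k q |q|≤
  ... | m , a , b , refl , |a|≤k , |b|≤k =
    Any.mapMaybe⁺ (join T u v) (allFin n) (Any.map⁺ (lose (∈-allFin m) joined))
    where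
    joined : MAny (λ p → weight x p ≤ weight x (a ◅◅ b)) (join T u v m)
    joined with T u m | T m v | opt u m a |a|≤k | opt m v b |b|≤k
    ... | just a′ | just b′ | just a′≤a | just b′≤b = just (begin
      weight x (a′ ◅◅ b′)        ≈⟨ weight-◅◅ x a′ b′ ⟩
      weight x a′ + weight x b′  ≤⟨ +-mono-≤ a′≤a b′≤b ⟩
      weight x a + weight x b    ≈⟨ weight-◅◅ x a b ⟨
      weight x (a ◅◅ b)          ∎)
      where open ≤-Reasoning

  difference : ∀ {u v} → Walk u v → Walk u v → Vector Carrier (suc d)
  difference p q i = form q i - form p i

  nonNeg-difference : ∀ {u v} (p q : Walk u v) y → NonNeg (difference p q) y ⇔ dot (form p) y ≤ dot (form q) y
  nonNeg-difference p q y = mk⇔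
    (λ 0≤ → 0≤-⇒≤ (≤-trans 0≤ (≤-reflexive (dot-‿-ˡ (form q) (form p) y))))
    (λ p≤q → ≤-trans (≤⇒0≤- p≤q) (≤-reflexive (sym (dot-‿-ˡ (form q) (form p) y))))

  -- Ordered pairs are taken because the sign of one difference decides only one direction of a
  -- comparison.
  differences : ∀ {u v} → List (Walk u v) → List (Vector Carrier (suc d))
  differences ps = concatMap (λ p → map (difference p) ps) ps

  length-differences : ∀ {u v} (ps : List (Walk u v)) {m} → length ps ℕ.≤ m → length (differences ps) ℕ.≤ m ℕ.* m
  length-differences ps {m} |ps|≤m = begin
    length (differences ps)  ≤⟨ length-concatMap-≤ _ (λ p → ℕ.≤-reflexive (length-map (difference p) ps)) ps ⟩
    length ps ℕ.* length ps  ≤⟨ ℕ.*-mono-≤ |ps|≤m |ps|≤m ⟩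
    m ℕ.* m                  ∎
    where open ℕ.≤-Reasoning

  ∈-differences : ∀ {u v} {ps : List (Walk u v)} {p q} → p ∈ ps → q ∈ ps → difference p q ∈ differences ps
  ∈-differences {p = p} p∈ps q∈ps = ∈-concatMap⁺ _ (lose p∈ps (∈-map⁺ (difference p) q∈ps))

  -- A representative `y` of a sign pattern need not end in `1#`, so walks are compared through
  -- their forms and not through `weight`.
  lightest : Vector Carrier (suc d) → ∀ {u v} → List (Walk u v) → Maybe (Walk u v)
  lightest y []       = nothing
  lightest y (p ∷ ps) = just (argmin (λ r → dot (form r) y) p ps)

  -- Equal signs of all differences mean that every comparison of candidates has the same outcome at
  -- `x` and at `y`, so a minimiser at `y` is one at `x`.
  lightest-optimal : ∀ {x y u v c} (ps : List (Walk u v)) → SameSigns (differences ps) (homogenise x) y →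
                     Any (λ p → weight x p ≤ c) ps → MAny (λ p → weight x p ≤ c) (lightest y ps)
  lightest-optimal {x} {y} {c = c} ps@(p₀ ∷ ps₀) x∼y some with find some
  ... | p , p∈ps , p≤c = just (begin
    weight x r                    ≈⟨ dot-form x r ⟨
    dot (form r) (homogenise x)   ≤⟨ Equivalence.to (nonNeg-difference r p (homogenise x))
                                       (Equivalence.from (All.lookup x∼y (∈-differences r∈ps p∈ps))
                                         (Equivalence.from (nonNeg-difference r p y) r≤p)) ⟩
    dot (form p) (homogenise x)   ≈⟨ dot-form x p ⟩
    weight x p                    ≤⟨ p≤c ⟩
    c                             ∎)
    where
    open ≤-Reasoning
    f = λ w → dot (form w) y
    r = argmin f p₀ ps₀
    r∈ps : r ∈ ps
    r∈ps = argmin-all f (here refl) (All.tabulate there)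
    r≤p : dot (form r) y ≤ dot (form p) y
    r≤p = All.lookup (f[argmin]≤f[⊤] {f = f} p₀ ps₀ ∷ f[argmin]≤f[xs] {f = f} p₀ ps₀) p∈ps

  comparisons : Table → List (Vector Carrier (suc d))
  comparisons T = concatMap (λ u → concatMap (λ v → differences (candidates T u v)) (allFin n)) (allFin n)

  -- Two factors count the endpoints, and two count an ordered pair of candidates, with at most one
  -- candidate per midpoint.
  length-comparisons : ∀ T → length (comparisons T) ℕ.≤ n ℕ.* (n ℕ.* (n ℕ.* n))
  length-comparisons T = over-allFin _ λ u → over-allFin _ λ v →
    length-differences (candidates T u v) (length-candidates T u v)
    where
    over-allFin : ∀ {A : Set} (f : Fin n → List A) {m} → (∀ u → length (f u) ℕ.≤ m) →
                  length (concatMap f (allFin n)) ℕ.≤ n ℕ.* m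
    over-allFin f {m} f≤m =
      ℕ.≤-trans (length-concatMap-≤ f f≤m (allFin n)) (ℕ.≤-reflexive (≡.cong (ℕ._* m) length-allFin))

  ∈-comparisons : ∀ T u v {g} → g ∈ differences (candidates T u v) → g ∈ comparisons T
  ∈-comparisons T u v g∈ = ∈-concatMap⁺ _ (lose (∈-allFin u) (∈-concatMap⁺ _ (lose (∈-allFin v) g∈)))

  -- All choices are made at y, which only has to order the candidates in the same
  -- way as the point of interest.
  double : Table → Vector Carrier (suc d) → Table
  double T y u v = lightest y (candidates T u v)

  double-optimal : ∀ {k x y T} → Optimal k x T → SameSigns (comparisons T) (homogenise x) y →
                   Optimal (k ℕ.+ k) x (double T y)
  double-optimal {T = T} opt x∼y u v q |q|≤ =
    lightest-optimal (candidates T u v)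
      (All.tabulate (λ g∈ → All.lookup x∼y (∈-comparisons T u v g∈)))
      (candidates-optimal opt u v q |q|≤)

  -- Counting tables over all points.

  module _ (em : ExcludedMiddle 0ℓ) where

    branching : ℕ
    branching = suc (n ℕ.* (n ℕ.* (n ℕ.* n))) ℕ.^ suc d

    patterns : ∀ T → Index (SameSigns (comparisons T)) branching
    patterns T =
      index-mono (ℕ.^-monoˡ-≤ (suc d) (s≤s (length-comparisons T))) (sign-patterns em (suc d) (comparisons T))

    -- The list is fixed before `x`. Each point follows its own branch, chosen at every stage by a
    -- representative with the same signs.
    tables : ∀ k → ∃ λ Ts → length Ts ℕ.≤ branching ℕ.^ k × (∀ x → Any (Optimal (2 ℕ.^ k) x) Ts)
    tables zero    = edges ∷ [] , s≤s z≤n , λ x → here (edges-optimal x)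
    tables (suc k) with tables k
    ... | Ts , |Ts|≤ , optimal = concatMap refinements Ts , bound , λ x →
        Any.concatMap⁺ refinements (Any.map (refined x) (optimal x))
      where
      refinements : Table → List Table
      refinements T = map (double T) (proj₁ (patterns T))

      bound : length (concatMap refinements Ts) ℕ.≤ branching ℕ.* branching ℕ.^ k
      bound = begin
        length (concatMap refinements Ts)
          ≤⟨ length-concatMap-≤ refinements (λ T → ℕ.≤-trans
               (ℕ.≤-reflexive (length-map (double T) (proj₁ (patterns T)))) (proj₁ (proj₂ (patterns T)))) Ts ⟩
        length Ts ℕ.* branching         ≤⟨ ℕ.*-monoˡ-≤ branching |Ts|≤ ⟩
        branching ℕ.^ k ℕ.* branching   ≡⟨ ℕ.*-comm _ branching ⟩
        branching ℕ.* branching ℕ.^ k   ∎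
        where open ℕ.≤-Reasoning

      refined : ∀ x {T} → Optimal (2 ℕ.^ k) x T → Any (Optimal (2 ℕ.^ suc k) x) (refinements T)
      refined x {T} opt = Any.map⁺ (Any.map (λ {y} x∼y →
        -- The power `2 ^ suc k` unfolds to `2 ^ k + (2 ^ k + 0)`.
        ≡.subst (λ m → Optimal m x (double T y)) (≡.cong (2 ℕ.^ k ℕ.+_) (≡.sym (ℕ.+-identityʳ _)))
          (double-optimal {T = T} opt x∼y))
        (proj₂ (proj₂ (patterns T)) (homogenise x)))

    -- From walks to covers by simple paths on a feasible region.

    module _ (S : Pred (Point ℝ d) 0ℓ) (feasible : Feasible G S) where

      cycle-nonneg : ∀ {x u} → S x → (c : Walk u u) → IsCycle c → 0# ≤ weight x c
      cycle-nonneg {x} Sx c cyc with total 0# (weight x c) | em {weight x c ≈ 0#}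
      ... | inj₁ 0≤w | _       = 0≤w
      ... | inj₂ _   | yes w≈0 = ≤-reflexive (sym w≈0)
      ... | inj₂ w≤0 | no  w≉0 = contradiction (w≤0 , w≉0) (feasible x Sx c cyc)

      -- Once the tail is simple, prepending `e` either keeps it simple or closes one cycle, which
      -- is dropped. The choice is combinatorial, so one path serves all points of `S`; feasibility
      -- makes the dropped weight nonnegative.
      erase-loops : ∀ {u v} (w : Walk u v) → ∃ λ (p : Walk u v) → IsPath p × (∀ x → S x → weight x p ≤ weight x w)
      erase-loops ε = ε , [] ∷ [] , λ _ _ → ≤-refl
      erase-loops {u} (e ◅ w) with erase-loops w
      ... | p , p-path , p≤w with DecMembership._∈?_ _≟_ u (vertices p)
      ...   | no  u∉p = e ◅ p , All.¬Any⇒All¬ _ u∉p ∷ p-path , λ x Sx → +-monoʳ-≤ _ (p≤w x Sx)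
      ...   | yes u∈p with cut p p-path u∈p
      ...     | a , b , refl , a-path , b-path = b , b-path , λ x Sx → begin
                weight x b                             ≈⟨ +-identityˡ _ ⟨
                0# + weight x b                        ≤⟨ +-mono-≤ (cycle-nonneg Sx (e ◅ a) a-path) ≤-refl ⟩
                wt x e + weight x a + weight x b       ≈⟨ +-assoc _ _ _ ⟩
                wt x e + (weight x a + weight x b)     ≈⟨ +-congˡ (weight-◅◅ x a b) ⟨
                wt x e + weight x (a ◅◅ b)             ≤⟨ +-monoʳ-≤ _ (p≤w x Sx) ⟩
                wt x e + weight x w                    ∎
        where open ≤-Reasoning

      -- Simple paths have at most `2 ^ k` edges, so the entry at `s` and `t` of an optimal table
      -- weighs no more than any of them, and neither does its loop erasure.
      cover : ∀ {s t} → (∃ λ (p : Walk s t) → IsPath p) → ∀ k → n ℕ.≤ 2 ℕ.^ k →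
              ∃ λ (ps : List (Walk s t)) → IsCover G S ps × length ps ℕ.≤ branching ℕ.^ k
      cover {s} {t} (p₀ , p₀-path) k n≤2^k =
        deduplicate _≟ʷ_ paths ,
        (Unique.deduplicate-! _≟ʷ_ paths , All.deduplicate⁺ _≟ʷ_ (All.map⁺ (All.universal path-erase walks)) , shortest) ,
        bound
        where
        _≟ʷ_ : (p q : Walk s t) → Dec (p ≡ q)
        p ≟ʷ q = em

        Ts = proj₁ (tables k)

        erase : Walk s t → Walk s t
        erase w = proj₁ (erase-loops w)

        path-erase : ∀ w → IsPath (erase w)
        path-erase w = proj₁ (proj₂ (erase-loops w))

        walks = mapMaybe (λ T → T s t) Ts
        paths = map erase walks

        bound : length (deduplicate _≟ʷ_ paths) ℕ.≤ branching ℕ.^ k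
        bound = begin
          length (deduplicate _≟ʷ_ paths)  ≤⟨ length-deduplicate _≟ʷ_ paths ⟩
          length paths                     ≡⟨ length-map erase walks ⟩
          length walks                     ≤⟨ length-mapMaybe (λ T → T s t) Ts ⟩
          length Ts                        ≤⟨ proj₁ (proj₂ (tables k)) ⟩
          branching ℕ.^ k                  ∎
          where open ℕ.≤-Reasoning

        LightestWalk : Point ℝ d → Walk s t → Set
        LightestWalk x w = ∀ q → IsPath q → weight x w ≤ weight x q

        lightest-entry : ∀ {x T} → Optimal (2 ℕ.^ k) x T → MAny (LightestWalk x) (T s t)
        lightest-entry {x} {T} opt with T s t | (λ q q-path → opt s t q (ℕ.≤-trans (path-steps≤n q q-path) n≤2^k))
        ... | just w  | best = just (λ q q-path → drop-just (best q q-path))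
        -- The given path from `s` to `t` is a competitor, so the entry cannot be empty.
        ... | nothing | best with () ← best p₀ p₀-path

        shortest : ∀ x → S x → ∃ λ p → p ∈ deduplicate _≟ʷ_ paths × IsShortestPath G x p
        shortest x Sx =
          let entries             = Any.map⁺ (Any.map (λ {T} → lightest-entry {x} {T}) (proj₂ (proj₂ (tables k)) x))
              w , w∈walks , w-min = find (Any.mapMaybe⁺ (λ T → T s t) Ts entries)
          in  erase w , ∈-deduplicate⁺ _≟ʷ_ (∈-map⁺ erase w∈walks) , path-erase w ,
              λ q q-path → ≤-trans (proj₂ (proj₂ (erase-loops w)) x Sx) (w-min q q-path)

      mspc : ∀ {s t} → (∃ λ (p : Walk s t) → IsPath p) → ∀ k → n ℕ.≤ 2 ℕ.^ k →
             ∃ λ (ps : List (Walk s t)) → IsMSPC G S ps × length ps ℕ.≤ branching ℕ.^ k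
      mspc path k n≤2^k with cover path k n≤2^k
      ... | qs , qs-cover , |qs|≤ with shortest-list em (IsCover G S) qs-cover
      ...   | ps , ps-cover , minimal = ps , (ps-cover , minimal) , ℕ.≤-trans (minimal qs qs-cover) |qs|≤

-- Arithmetic of the final bound.

-- The witness is the ceiling of log₂ n: passing from `n` to `n + 1` raises it exactly when `n`
-- equals `2 ^ k`.
ceiling-power : ∀ n → 1 ℕ.≤ n → ∃ λ k → n ℕ.≤ 2 ℕ.^ k × 2 ℕ.^ k ℕ.≤ 2 ℕ.* n
ceiling-power 1             _ = 0 , s≤s z≤n , s≤s z≤n
ceiling-power (suc n@(suc _)) _ with ceiling-power n (s≤s z≤n)
... | k , n≤2^k , 2^k≤2n with ℕ.m≤n⇒m<n∨m≡n n≤2^k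
...   | inj₁ n<2^k = k , n<2^k , ℕ.≤-trans 2^k≤2n (ℕ.*-monoʳ-≤ 2 (ℕ.n≤1+n n))
...   | inj₂ n≡2^k = suc k ,
        (begin
          1 ℕ.+ n        ≤⟨ ℕ.+-monoˡ-≤ n (s≤s z≤n) ⟩
          n ℕ.+ n        ≡⟨ ≡.cong (n ℕ.+_) (ℕ.+-identityʳ n) ⟨
          2 ℕ.* n        ≡⟨ ≡.cong (2 ℕ.*_) n≡2^k ⟩
          2 ℕ.^ suc k    ∎) ,
        (begin
          2 ℕ.^ suc k    ≡⟨ ≡.cong (2 ℕ.*_) n≡2^k ⟨
          2 ℕ.* n        ≤⟨ ℕ.*-monoʳ-≤ 2 (ℕ.n≤1+n n) ⟩
          2 ℕ.* suc n    ∎)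
        where open ℕ.≤-Reasoning

2^-cancel-≤ : ∀ {a b} → 2 ℕ.^ a ℕ.≤ 2 ℕ.^ b → a ℕ.≤ b
2^-cancel-≤ 2^a≤2^b = ℕ.≮⇒≥ (λ b<a → ℕ.<⇒≱ (ℕ.^-monoʳ-< 2 (s≤s (s≤s z≤n)) b<a) 2^a≤2^b)

^-distribʳ-* : ∀ o m n → (m ℕ.* n) ℕ.^ o ≡ m ℕ.^ o ℕ.* n ℕ.^ o
^-distribʳ-* zero    m n = refl
^-distribʳ-* (suc o) m n = ≡.trans (≡.cong (m ℕ.* n ℕ.*_) (^-distribʳ-* o m n))
                                   (ℕ.[m*n]*[o*p]≡[m*o]*[n*p] m n (m ℕ.^ o) (n ℕ.^ o))

-- This is `k ≤ 1 + log₂ n ≤ 2 log₂ n` with `p / q` for the logarithm and the denominator cleared.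
-- The second inequality becomes `q ≤ p`, which follows from `2 ≤ n`.
rounds-≤ : ∀ {n k p q} → 2 ℕ.≤ n → 2 ℕ.^ k ℕ.≤ 2 ℕ.* n → n ℕ.^ q ℕ.≤ 2 ℕ.^ p → k ℕ.* q ℕ.≤ 2 ℕ.* p
rounds-≤ {n} {k} {p} {q} 2≤n 2^k≤2n n^q≤2^p = begin
  k ℕ.* q  ≤⟨ 2^-cancel-≤ (begin
    2 ℕ.^ (k ℕ.* q)      ≡⟨ ℕ.^-*-assoc 2 k q ⟨
    (2 ℕ.^ k) ℕ.^ q      ≤⟨ ℕ.^-monoˡ-≤ q 2^k≤2n ⟩
    (2 ℕ.* n) ℕ.^ q      ≡⟨ ^-distribʳ-* q 2 n ⟩
    2 ℕ.^ q ℕ.* n ℕ.^ q  ≤⟨ ℕ.*-monoʳ-≤ (2 ℕ.^ q) n^q≤2^p ⟩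
    2 ℕ.^ q ℕ.* 2 ℕ.^ p  ≡⟨ ℕ.^-distribˡ-+-* 2 q p ⟨
    2 ℕ.^ (q ℕ.+ p)      ∎) ⟩
  q ℕ.+ p  ≤⟨ ℕ.+-monoˡ-≤ p (2^-cancel-≤ (ℕ.≤-trans (ℕ.^-monoˡ-≤ q 2≤n) n^q≤2^p)) ⟩
  p ℕ.+ p  ≡⟨ ≡.cong (p ℕ.+_) (ℕ.+-identityʳ p) ⟨
  2 ℕ.* p  ∎
  where open ℕ.≤-Reasoning

-- Replaces the base of the branching factor by a power of `n`, so that only exponents remain to be
-- compared.
suc[n⁴]≤n⁵ : ∀ {n} → 2 ℕ.≤ n → suc (n ℕ.* (n ℕ.* (n ℕ.* n))) ℕ.≤ n ℕ.^ 5
suc[n⁴]≤n⁵ {n@(suc _)} 2≤n = begin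
  1 ℕ.+ m                              ≤⟨ ℕ.+-monoˡ-≤ m (s≤s z≤n) ⟩
  m ℕ.+ m                              ≡⟨ ≡.cong (m ℕ.+_) (ℕ.+-identityʳ m) ⟨
  2 ℕ.* m                              ≤⟨ ℕ.*-monoˡ-≤ m 2≤n ⟩
  n ℕ.* m                              ≡⟨ lemma n ⟩
  n ℕ.^ 5                              ∎
  where
  open ℕ.≤-Reasoning
  m = n ℕ.* (n ℕ.* (n ℕ.* n))
  lemma : ∀ n → n ℕ.* (n ℕ.* (n ℕ.* (n ℕ.* n))) ≡ n ℕ.* (n ℕ.* (n ℕ.* (n ℕ.* (n ℕ.* 1))))
  lemma = solve-∀

-- 20 = 5 · 2 · 2, from n⁴ + 1 ≤ n⁵, d + 1 ≤ 2 d and k ≤ 2 log₂ n.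
branching-bound : ∀ {n d k m} → 2 ℕ.≤ n → 1 ℕ.≤ d → 2 ℕ.^ k ℕ.≤ 2 ℕ.* n →
                  m ℕ.≤ (suc (n ℕ.* (n ℕ.* (n ℕ.* n))) ℕ.^ suc d) ℕ.^ k → m ≼ n ^[ 20 ℕ.* d ·log₂ n ]
branching-bound {n@(suc _)} {d} {k} {m} 2≤n 1≤d 2^k≤2n m≤ p q _ n^q≤2^p = begin
  m ℕ.^ q                                ≤⟨ ℕ.^-monoˡ-≤ q m≤ ⟩
  ((b ℕ.^ suc d) ℕ.^ k) ℕ.^ q            ≤⟨ ℕ.^-monoˡ-≤ q (ℕ.^-monoˡ-≤ k (ℕ.^-monoˡ-≤ (suc d) (suc[n⁴]≤n⁵ 2≤n))) ⟩
  (((n ℕ.^ 5) ℕ.^ suc d) ℕ.^ k) ℕ.^ q    ≡⟨ ℕ.^-*-assoc ((n ℕ.^ 5) ℕ.^ suc d) k q ⟩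
  ((n ℕ.^ 5) ℕ.^ suc d) ℕ.^ (k ℕ.* q)    ≡⟨ ≡.cong (ℕ._^ (k ℕ.* q)) (ℕ.^-*-assoc n 5 (suc d)) ⟩
  (n ℕ.^ (5 ℕ.* suc d)) ℕ.^ (k ℕ.* q)    ≡⟨ ℕ.^-*-assoc n (5 ℕ.* suc d) (k ℕ.* q) ⟩
  n ℕ.^ (5 ℕ.* suc d ℕ.* (k ℕ.* q))      ≤⟨ ℕ.^-monoʳ-≤ n (ℕ.*-mono-≤ (ℕ.*-monoʳ-≤ 5 (ℕ.+-monoˡ-≤ d 1≤d))
                                              (rounds-≤ {n} {k} {p} {q} 2≤n 2^k≤2n n^q≤2^p)) ⟩
  n ℕ.^ (5 ℕ.* (d ℕ.+ d) ℕ.* (2 ℕ.* p))  ≡⟨ ≡.cong (n ℕ.^_) (lemma d p) ⟩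
  n ℕ.^ (20 ℕ.* d ℕ.* p)                 ∎
  where
  open ℕ.≤-Reasoning
  b = suc (n ℕ.* (n ℕ.* (n ℕ.* n)))
  lemma : ∀ d p → 5 ℕ.* (d ℕ.+ d) ℕ.* (2 ℕ.* p) ≡ 20 ℕ.* d ℕ.* p
  lemma = solve-∀

open import Data.Nat.Base using (_≤_; _<_; _*_)

theorem3 : ∃ λ (C : ℕ) → 0 < C ×
    (ExcludedMiddle 0ℓ →
    ∀ (ℝ : RealNumbers) (n d : ℕ) → 2 ≤ n → 1 ≤ d →
    ∀ (G : ParametricGraph ℝ n d) → ParametricGraph.Connected G →
    ∀ (s t : Fin n) → (∃ λ (p : ParametricGraph.Walk G s t) → ParametricGraph.IsPath G p) →
    ∀ (S : Pred (Point ℝ d) 0ℓ) → Feasible G S →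
    ∃ λ (𝒮 : List (ParametricGraph.Walk G s t)) →
    IsMSPC G S 𝒮 × length 𝒮 ≼ n ^[ C * d ·log₂ n ])
theorem3 = 20 , s≤s z≤n , λ em ℝ n d 2≤n 1≤d G _ s t path S feasible →
  let k , n≤2^k , 2^k≤2n = ceiling-power n (ℕ.≤-trans (s≤s z≤n) 2≤n)
      𝒮 , 𝒮-mspc , |𝒮|≤  = Tables.mspc G em S feasible path k n≤2^k
  in  𝒮 , 𝒮-mspc , branching-bound {k = k} 2≤n 1≤d 2^k≤2n |𝒮|≤
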